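{- Let $F$ be a one-dimensional tropical fan in $\mathbb{R}^n$ whose rays span $\mathbb{R}^n$, and let $\pi:\mathbb{Z}^n\to\mathbb{Z}^k$ be a linear map such that $\pi_*(F)$ is a one-dimensional tropical fan. Call the set of rays of $F$ that are mapped by $\pi$ onto a ray of $\pi_*(F)$ the fibre of $\pi_*(F)$. If $\pi_*(F)$ is a one-dimensional Bergman fan in $\mathbb{R}^k$, then the fibre of $\pi_*(F)$ is contained in some gallery class of $F$.
   Context: A one-dimensional tropical fan $F$ in $\mathbb{R}^n$ consists of finitely many distinct rays $\mathbb{R}_+v_1,\dots,\mathbb{R}_+v_q$ (and the origin), with $v_i\in\mathbb{Z}^n$ primitive, together with positive integer weights $\omega_1,\dots,\omega_q$ satisfying the balancing condition $\sum_i\omega_iv_i=0$. The push-forward $\pi_*(F)$ under an integer linear map $\pi$ has as rays the half-lines spanned by the nonzero $\pi(v_i)$; the weight of the ray with primitive generator $u$ is $\sum\omega_im_i$, the sum over all $i$ with $\pi(v_i)=m_iu$, $m_i>0$. A one-dimensional Bergman fan in $\mathbb{R}^k$ ($k\ge1$) is the tropical fan with rays generated by $u_0,u_1,\dots,u_k$, all of weight $1$, where $u_1,\dots,u_k$ is a $\mathbb{Z}$-basis of $\mathbb{Z}^k$ and $u_0=-(u_1+\dots+u_k)$. For $l\in(\mathbb{Z}^n)^\vee$ put $\max(0,l)\cdot F=\sum_i\omega_i\max(0,l(v_i))$. If this equals $1$, the gallery of $F$ over $\max(0,l)$ is the set of rays $\mathbb{R}_+v_i$ of $F$ with $|l(v_i)|=1$;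 it always consists of exactly two rays. The relation on rays "equal, or together forming a gallery of $F$" is an equivalence relation; its equivalence classes are called gallery classes here. -}

module Defs where

open import Algebra.Bundles using (Ring)
open import Algebra.Module.Bundles.Raw using (RawLeftModule)
import Algebra.Module.Construct.TensorUnit as TensorUnit
open import Algebra.Module.Morphism.Structures using (module LeftModuleMorphisms)
import Algebra.Properties.Monoid.Sum as MonoidSum
open import Data.Fin.Base using (Fin; zero; suc)
open import Data.Integer.Base as ℤ using (ℤ; +_; 0ℤ; 1ℤ; ∣_∣)
open import Data.Integer.Divisibility using (_∣_)
import Data.Integer.Properties as ℤ
open import Data.Nat.Base as ℕ using (ℕ; suc)
import Data.Nat.Properties as ℕ
open import Data.Product.Base using (∃; _×_)
open import Data.Rational.Base as ℚ using (ℚ)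
import Data.Rational.Properties as ℚ
open import Data.Sum.Base using (_⊎_)
open import Data.Vec.Functional using (Vector)
open import Function.Base using (_∘_)
open import Level using (0ℓ)
open import Relation.Binary.Core using (Rel)
open import Relation.Binary.PropositionalEquality.Core using (_≡_; _≗_)
open import Relation.Nullary.Negation.Core using (¬_)
open import Relation.Unary using (Pred; _≐_; _∪_; ｛_｝)

open MonoidSum ℕ.+-0-monoid using () renaming (sum to sumℕ) public
open MonoidSum ℤ.+-0-monoid using () renaming (sum to sumℤ) public
open MonoidSum ℚ.+-0-monoid using () renaming (sum to sumℚ) public

private
  variable
    n k q : ℕ

ℤ^_ : ℕ → RawLeftModule ℤ 0ℓ 0ℓ
ℤ^ n = record
  { Carrierᴹ = Vector ℤ n
  ; _≈ᴹ_     = _≗_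
  ; _+ᴹ_     = λ x y j → x j ℤ.+ y j
  ; _*ₗ_     = λ a x j → a ℤ.* x j
  ; 0ᴹ       = λ _ → 0ℤ
  ; -ᴹ_      = λ x j → ℤ.- x j
  }

0ᵛ : Vector ℤ n
0ᵛ {n} = RawLeftModule.0ᴹ (ℤ^ n)

-ᵛ_ : Vector ℤ n → Vector ℤ n
-ᵛ_ {n} = RawLeftModule.-ᴹ_ (ℤ^ n)

infixr 7 _·_
_·_ : ℤ → Vector ℤ n → Vector ℤ n
_·_ {n} = RawLeftModule._*ₗ_ (ℤ^ n)

combination : Vector ℤ q → Vector (Vector ℤ n) q → Vector ℤ n
combination c v j = sumℤ (λ i → c i ℤ.* v i j)

record LinearMap (n k : ℕ) : Set where
  open LeftModuleMorphisms (ℤ^ n) (ℤ^ k)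
  field
    apply    : Vector ℤ n → Vector ℤ k
    isLinear : IsLeftModuleHomomorphism apply

record Dual (n : ℕ) : Set where
  open LeftModuleMorphisms (ℤ^ n) (TensorUnit.rawLeftModule {R = Ring.rawRing ℤ.+-*-ring})
  field
    apply    : Vector ℤ n → ℤ
    isLinear : IsLeftModuleHomomorphism apply

-- Excludes the zero vector, which every d divides.
Primitive : Pred (Vector ℤ n) 0ℓ
Primitive v = ∀ d → (∀ j → + d ∣ v j) → d ≡ 1

-- A ray is represented by its primitive generator, so rays are distinct
-- exactly when their generators are.  A fan with no rays is the origin
-- alone and is not one-dimensional.
record TropicalFan (n : ℕ) : Set where
  field
    #rays       : ℕ
    nonEmpty    : 0 ℕ.< #rays
    generator   : Vector (Vector ℤ n) #rays
    isPrimitive : ∀ i → Primitive (generator i)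
    distinct    : ∀ {i j} → generator i ≗ generator j → i ≡ j
    weight      : Vector ℕ #rays
    positive    : ∀ i → 0 ℕ.< weight i
    balanced    : combination (+_ ∘ weight) generator ≗ 0ᵛ

  Ray : Set
  Ray = Fin #rays

open TropicalFan

-- Integer vectors span ℝⁿ over ℝ if and only if they span ℚⁿ over ℚ.
RaysSpan : TropicalFan n → Set
RaysSpan {n} F = (w : Vector ℚ n) → ∃ λ (c : Vector ℚ (#rays F)) →
  ∀ j → w j ≡ sumℚ (λ i → c i ℚ.* (generator F i j ℚ./ 1))

-- For primitive u: w is nonzero and spans the same half-line as u.
SpansRay : Vector ℤ n → Vector ℤ n → Set
SpansRay w u = ∃ λ m → 0 ℕ.< m × w ≗ + m · u

-- The m with w = m u and m > 0, extended by 0 when there is none.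
IsMultiplicity : Vector ℤ n → Vector ℤ n → ℕ → Set
IsMultiplicity w u m = (0 ℕ.< m × w ≗ + m · u) ⊎ (¬ SpansRay w u × m ≡ 0)

-- MapsOnto π F G i j: the map π sends the ray i of F onto the ray j of G.
MapsOnto : LinearMap n k → (F : TropicalFan n) (G : TropicalFan k) → Ray F → Ray G → Set
MapsOnto π F G i j = SpansRay (LinearMap.apply π (generator F i)) (generator G j)

-- These conditions determine G up to a permutation of its rays.
record IsPushForward (π : LinearMap n k) (F : TropicalFan n) (G : TropicalFan k) : Set where
  image : Ray F → Vector ℤ k
  image i = LinearMap.apply π (generator F i)
  field
    image-ray : ∀ i → ¬ (image i ≗ 0ᵛ) → ∃ λ j → MapsOnto π F G i j
    ray-image : ∀ j → ∃ λ i → MapsOnto π F G i j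
    weight-sum : ∀ j → ∃ λ (m : Vector ℕ (#rays F)) →
      (∀ i → IsMultiplicity (image i) (generator G j) (m i)) ×
      weight G j ≡ sumℕ (λ i → weight F i ℕ.* m i)

record IsBasis (u : Vector (Vector ℤ k) k) : Set where
  field
    spanning    : ∀ w → ∃ λ c → w ≗ combination c u
    independent : ∀ c → combination c u ≗ 0ᵛ → c ≗ 0ᵛ

-- The vectors u₀, …, u_k are automatically primitive, so they are compared
-- directly with the ray generators.
record IsBergman {k : ℕ} (G : TropicalFan k) : Set where
  field
    k≥1        : 1 ℕ.≤ k
    u          : Vector (Vector ℤ k) (suc k)
    isBasis    : IsBasis (u ∘ suc)
    u₀         : u zero ≗ -ᵛ combination (λ _ → 1ℤ) (u ∘ suc)
    u-ray      : ∀ a → ∃ λ j → generator G j ≗ u a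
    ray-u      : ∀ j → ∃ λ a → generator G j ≗ u a
    weight-one : ∀ j → weight G j ≡ 1

max0_∙_ : Dual n → TropicalFan n → ℤ
max0 l ∙ F = sumℤ (λ i → + weight F i ℤ.* (0ℤ ℤ.⊔ Dual.apply l (generator F i)))

IsGallery : (F : TropicalFan n) → Pred (Pred (Ray F) 0ℓ) 0ℓ
IsGallery {n} F S = ∃ λ (l : Dual n) →
  max0 l ∙ F ≡ 1ℤ × S ≐ (λ i → ∣ Dual.apply l (generator F i) ∣ ≡ 1)

GalleryRelated : (F : TropicalFan n) → Rel (Ray F) 0ℓ
GalleryRelated F i j = i ≡ j ⊎ IsGallery F (｛ i ｝ ∪ ｛ j ｝)

IsGalleryClass : (F : TropicalFan n) → Pred (Pred (Ray F) 0ℓ) 0ℓ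
IsGalleryClass F C = ∃ λ i → C ≐ GalleryRelated F i

Fibre : LinearMap n k → (F : TropicalFan n) → TropicalFan k → Pred (Ray F) 0ℓ
Fibre π F G i = ∃ λ j → MapsOnto π F G i j

{-# OPTIONS --safe #-}
-- Since every ray of π∗F has weight 1, exactly one ray of F maps onto it, and
-- the generator of that ray is sent to the generator u a.  For a ≢ b let l be the
-- functional on ℤᵏ taking the values 1 on u a, -1 on u b and 0 on the remaining
-- u c: it is the difference of the a-th and b-th coordinates in the basis
-- u₁, …, u_k, the 0-th coordinate being 0.  Then max(0, l ∘ π) · F is the weight
-- of the ray u a of π∗F, hence 1, and the gallery of F over max(0, l ∘ π)
-- consists of the two rays of F over u a and u b.
module Submission where

open import Defs
open import Algebra.Module.Morphism.Construct.Composition using (isLeftModuleHomomorphism)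
open import Algebra.Module.Morphism.Structures using (module LeftModuleMorphisms)
import Algebra.Properties.Semiring.Sum as SemiringSum
open import Data.Fin.Base using (Fin; zero; suc)
open import Data.Fin.Properties using (_≟_; all?)
open import Data.Integer.Base as ℤ using (ℤ; +_; 0ℤ; 1ℤ; -1ℤ; ∣_∣)
import Data.Integer.Properties as ℤ
open import Data.Integer.Tactic.RingSolver using (solve-∀)
open import Data.Nat.Base as ℕ using (ℕ; suc)
import Data.Nat.Properties as ℕ
open import Data.Product.Base using (∃; _×_; _,_; proj₁; proj₂)
open import Data.Sum.Base using (_⊎_; inj₁; inj₂)
open import Data.Vec.Functional using (Vector; _∷_)
open import Function.Base using (id; _∘_)
open import Level using (0ℓ)
open import Relation.Binary.PropositionalEquality
open import Relation.Nullary.Decidable using (yes; no)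
open import Relation.Nullary.Negation using (contradiction)
open import Relation.Unary using (Pred; _⊆_)

open SemiringSum ℤ.+-*-semiring using (∑-distrib-+; *-distribˡ-sum; sum-cong-≗; sum-replicate-zero)
open TropicalFan
open ≡-Reasoning

private
  variable
    n k : ℕ

-- Finite sums of natural numbers and integers.

sumℤ-pos : (f : Vector ℕ n) → sumℤ (+_ ∘ f) ≡ + sumℕ f
sumℤ-pos {ℕ.zero} f = refl
sumℤ-pos {suc n}  f = trans (cong (ℤ._+_ (+ f zero)) (sumℤ-pos (f ∘ suc))) (sym (ℤ.pos-+ (f zero) _))

entry≤sumℕ : (f : Vector ℕ n) (i : Fin n) → f i ℕ.≤ sumℕ f
entry≤sumℕ f zero    = ℕ.m≤m+n _ _
entry≤sumℕ f (suc i) = ℕ.≤-trans (entry≤sumℕ (f ∘ suc) i) (ℕ.m≤n+m _ _)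

-- Positive entries at two different indices would already add up to at least 2.
sumℕ≤1⇒unique : (f : Vector ℕ n) → sumℕ f ℕ.≤ 1 → ∀ i j → 0 ℕ.< f i → 0 ℕ.< f j → i ≡ j
sumℕ≤1⇒unique f s zero    zero    p q = refl
sumℕ≤1⇒unique f s zero    (suc j) p q =
  contradiction (ℕ.≤-trans (ℕ.+-mono-≤ p (ℕ.≤-trans q (entry≤sumℕ (f ∘ suc) j))) s) λ { (ℕ.s≤s ()) }
sumℕ≤1⇒unique f s (suc i) zero    p q = sym (sumℕ≤1⇒unique f s zero (suc i) q p)
sumℕ≤1⇒unique f s (suc i) (suc j) p q =
  cong suc (sumℕ≤1⇒unique (f ∘ suc) (ℕ.m+n≤o⇒n≤o (f zero) s) i j p q)

-- The Kronecker delta and linear combinations.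

δ : Fin n → Vector ℤ n
δ zero    zero    = 1ℤ
δ zero    (suc j) = 0ℤ
δ (suc i) zero    = 0ℤ
δ (suc i) (suc j) = δ i j

δ-refl : (i : Fin n) → δ i i ≡ 1ℤ
δ-refl zero    = refl
δ-refl (suc i) = δ-refl i

δ-sym : (i j : Fin n) → δ i j ≡ δ j i
δ-sym zero    zero    = refl
δ-sym zero    (suc j) = refl
δ-sym (suc i) zero    = refl
δ-sym (suc i) (suc j) = δ-sym i j

δ-≢ : {i j : Fin n} → i ≢ j → δ i j ≡ 0ℤ
δ-≢ {i = zero}  {zero}  i≢j = contradiction refl i≢j
δ-≢ {i = zero}  {suc j} i≢j = refl
δ-≢ {i = suc i} {zero}  i≢j = refl
δ-≢ {i = suc i} {suc j} i≢j = δ-≢ (i≢j ∘ cong suc)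

sumℤ-δ : (i : Fin n) (f : Vector ℤ n) → sumℤ (λ j → δ i j ℤ.* f j) ≡ f i
sumℤ-δ {suc n} zero    f = begin
  1ℤ ℤ.* f zero ℤ.+ sumℤ (λ j → 0ℤ ℤ.* f (suc j))
    ≡⟨ cong₂ ℤ._+_ (ℤ.*-identityˡ (f zero)) (sum-replicate-zero n) ⟩
  f zero ℤ.+ 0ℤ
    ≡⟨ ℤ.+-identityʳ (f zero) ⟩
  f zero ∎
sumℤ-δ {suc n} (suc i) f = trans (ℤ.+-identityˡ _) (sumℤ-δ i (f ∘ suc))

combination-+ : ∀ {q} (c d : Vector ℤ q) (v : Vector (Vector ℤ n) q) →
  combination (λ i → c i ℤ.+ d i) v ≗ λ j → combination c v j ℤ.+ combination d v j
combination-+ c d v j = trans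
  (sum-cong-≗ (λ i → ℤ.*-distribʳ-+ (v i j) (c i) (d i)))
  (∑-distrib-+ (λ i → c i ℤ.* v i j) (λ i → d i ℤ.* v i j))

combination-* : ∀ {q} a (c : Vector ℤ q) (v : Vector (Vector ℤ n) q) →
  combination (a · c) v ≗ a · combination c v
combination-* a c v j = trans
  (sum-cong-≗ (λ i → ℤ.*-assoc a (c i) (v i j)))
  (sym (*-distribˡ-sum a (λ i → c i ℤ.* v i j)))

-- Linear functionals.

mkDual : (f : Vector ℤ n → ℤ) →
  (∀ {x y} → x ≗ y → f x ≡ f y) →
  (∀ x y → f (λ j → x j ℤ.+ y j) ≡ f x ℤ.+ f y) →
  (∀ a x → f (a · x) ≡ a ℤ.* f x) →
  Dual n
mkDual f f-cong f-+ f-* = record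
  { apply    = f
  ; isLinear = record
    { +ᴹ-isGroupHomomorphism = record
      { isMonoidHomomorphism = record
        { isMagmaHomomorphism = record
          { isRelHomomorphism = record { cong = f-cong }
          ; homo              = f-+
          }
        -- By computation `0ℤ · 0ᵛ` is `0ᵛ` and `0ℤ ℤ.* f 0ᵛ` is `0ℤ`, so homogeneity at the scalar
        -- 0 has the required type.
        ; ε-homo = f-* 0ℤ 0ᵛ
        }
      ; ⁻¹-homo = λ x → begin
          f (-ᵛ x)      ≡⟨ f-cong (λ j → sym (ℤ.-1*i≡-i (x j))) ⟩
          f (-1ℤ · x)   ≡⟨ f-* -1ℤ x ⟩
          -1ℤ ℤ.* f x   ≡⟨ ℤ.-1*i≡-i (f x) ⟩
          ℤ.- f x       ∎
      }
    ; *ₗ-homo = f-*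
    }
  }

pullback : LinearMap n k → Dual k → Dual n
pullback π l = record
  { apply    = Dual.apply l ∘ LinearMap.apply π
  ; isLinear = isLeftModuleHomomorphism trans (LinearMap.isLinear π) (Dual.isLinear l)
  }

module DualProperties (l : Dual n) where
  open Dual l
  open LeftModuleMorphisms.IsLeftModuleHomomorphism isLinear public
    renaming (⟦⟧-cong to apply-cong; 0ᴹ-homo to apply-0; *ₗ-homo to apply-*)

-- Coordinates with respect to a lattice basis.

module Coordinates {u : Vector (Vector ℤ k) k} (isBasis : IsBasis u) where
  open IsBasis isBasis

  coordinates : Vector ℤ k → Vector ℤ k
  coordinates w = proj₁ (spanning w)

  -- The difference of two expansions of `w` is a vanishing combination, so independence applies.
  -- Every later property of `coordinates` follows by exhibiting some expansion of the vector in
  -- question.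
  coordinates-unique : ∀ {w} c → w ≗ combination c u → coordinates w ≗ c
  coordinates-unique {w} c w≗c i = ℤ.i-j≡0⇒i≡j _ _ (begin
    coordinates w i ℤ.- c i   ≡⟨ cong (ℤ._+_ (coordinates w i)) (ℤ.-1*i≡-i (c i)) ⟨
    difference i              ≡⟨ independent difference vanishes i ⟩
    0ℤ                        ∎)
    where
    difference : Vector ℤ k
    difference i = coordinates w i ℤ.+ -1ℤ ℤ.* c i

    vanishes : combination difference u ≗ 0ᵛ
    vanishes j = begin
      combination difference u j
        ≡⟨ combination-+ (coordinates w) (-1ℤ · c) u j ⟩
      combination (coordinates w) u j ℤ.+ combination (-1ℤ · c) u j
        ≡⟨ cong₂ ℤ._+_ (sym (proj₂ (spanning w) j)) (combination-* -1ℤ c u j) ⟩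
      w j ℤ.+ -1ℤ ℤ.* combination c u j
        ≡⟨ cong₂ ℤ._+_ (w≗c j) (ℤ.-1*i≡-i _) ⟩
      combination c u j ℤ.- combination c u j
        ≡⟨ ℤ.+-inverseʳ (combination c u j) ⟩
      0ℤ ∎

  coordinates-cong : ∀ {x y} → x ≗ y → coordinates x ≗ coordinates y
  coordinates-cong {x} {y} x≗y = coordinates-unique _ λ j → trans (x≗y j) (proj₂ (spanning y) j)

  coordinates-+ : ∀ x y →
    coordinates (λ j → x j ℤ.+ y j) ≗ λ i → coordinates x i ℤ.+ coordinates y i
  coordinates-+ x y = coordinates-unique _ λ j → trans
    (cong₂ ℤ._+_ (proj₂ (spanning x) j) (proj₂ (spanning y) j))
    (sym (combination-+ (coordinates x) (coordinates y) u j))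

  coordinates-* : ∀ a x → coordinates (a · x) ≗ a · coordinates x
  coordinates-* a x = coordinates-unique _ λ j → trans
    (cong (ℤ._*_ a) (proj₂ (spanning x) j))
    (sym (combination-* a (coordinates x) u j))

  coordinates-basis : ∀ i → coordinates (u i) ≗ δ i
  coordinates-basis i = coordinates-unique (δ i) λ j → sym (sumℤ-δ i (λ m → u m j))

  coordinates-negSum : ∀ {w} → w ≗ -ᵛ combination (λ _ → 1ℤ) u → coordinates w ≗ λ _ → -1ℤ
  coordinates-negSum w≗ = coordinates-unique _ λ j → trans (w≗ j)
    (sym (trans (combination-* -1ℤ (λ _ → 1ℤ) u j) (ℤ.-1*i≡-i _)))

  -- Prepending the zero functional indexes the coordinates like the `k + 1` vectors of a Bergman
  -- fan, so that `u zero` needs no separate treatment later.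
  coordinate : Fin (suc k) → Dual k
  coordinate a = mkDual (λ w → (0ℤ ∷ coordinates w) a) (c-cong a) (c-+ a) (c-* a)
    where
    c-cong : ∀ a {x y} → x ≗ y → (0ℤ ∷ coordinates x) a ≡ (0ℤ ∷ coordinates y) a
    c-cong zero    x≗y = refl
    c-cong (suc a) x≗y = coordinates-cong x≗y a

    c-+ : ∀ a x y → (0ℤ ∷ coordinates (λ j → x j ℤ.+ y j)) a ≡
      (0ℤ ∷ coordinates x) a ℤ.+ (0ℤ ∷ coordinates y) a
    c-+ zero    x y = refl
    c-+ (suc a) x y = coordinates-+ x y a

    c-* : ∀ a b x → (0ℤ ∷ coordinates (b · x)) a ≡ b ℤ.* (0ℤ ∷ coordinates x) a
    c-* zero    b x = sym (ℤ.*-zeroʳ b)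
    c-* (suc a) b x = coordinates-* b x a

_-ᵈ_ : Dual n → Dual n → Dual n
l -ᵈ m = mkDual (λ x → L.apply x ℤ.- M.apply x)
  (λ x≗y → cong₂ ℤ._-_ (LP.apply-cong x≗y) (MP.apply-cong x≗y))
  (λ x y → trans (cong₂ ℤ._-_ (LP.+ᴹ-homo x y) (MP.+ᴹ-homo x y)) (interchange (L.apply x) _ _ _))
  (λ a x → trans (cong₂ ℤ._-_ (LP.apply-* a x) (MP.apply-* a x)) (factor a _ _))
  where
  module L = Dual l
  module M = Dual m
  module LP = DualProperties l
  module MP = DualProperties m

  interchange : ∀ a b c d → (a ℤ.+ b) ℤ.- (c ℤ.+ d) ≡ (a ℤ.- c) ℤ.+ (b ℤ.- d)
  interchange = solve-∀

  factor : ∀ a b c → a ℤ.* b ℤ.- a ℤ.* c ≡ a ℤ.* (b ℤ.- c)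
  factor = solve-∀

-- Functionals separating two rays of a Bergman fan.

module BergmanFan {G : TropicalFan k} (bergman : IsBergman G) where
  open IsBergman bergman
  open Coordinates isBasis

  -- The term `δ zero c` records that each coordinate in the basis is -1 on `u zero`, which is minus
  -- the sum of the basis. It does not depend on `a` and therefore cancels in differences of
  -- coordinates.
  coordinate-u : ∀ a c → Dual.apply (coordinate a) (u c) ≡ δ a c ℤ.- δ zero c
  coordinate-u zero    zero    = refl
  coordinate-u zero    (suc c) = refl
  coordinate-u (suc a) zero    = coordinates-negSum u₀ a
  coordinate-u (suc a) (suc c) = begin
    coordinates (u (suc c)) a   ≡⟨ coordinates-basis c a ⟩
    δ c a                       ≡⟨ δ-sym c a ⟩
    δ a c                       ≡⟨ ℤ.+-identityʳ (δ a c) ⟨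
    δ a c ℤ.- 0ℤ                ∎

  separate : Fin (suc k) → Fin (suc k) → Dual k
  separate a b = coordinate a -ᵈ coordinate b

  separate-u : ∀ a b c → Dual.apply (separate a b) (u c) ≡ δ a c ℤ.- δ b c
  separate-u a b c = trans
    (cong₂ ℤ._-_ (coordinate-u a c) (coordinate-u b c))
    (cancel (δ a c) (δ b c) (δ zero c))
    where
    cancel : ∀ x y z → (x ℤ.- z) ℤ.- (y ℤ.- z) ≡ x ℤ.- y
    cancel = solve-∀

-- The rays of `F` over the rays of a Bergman push-forward.

module PushForward {F : TropicalFan n} {π : LinearMap n k} {G : TropicalFan k}
  (pushForward : IsPushForward π F G) (bergman : IsBergman G) where

  open IsPushForward pushForward
  open IsBergman bergman
  open BergmanFan bergman

  Over : Ray F → Fin (suc k) → Set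
  Over i a = SpansRay (image i) (u a)

  -- This is the weight formula of the push-forward at the ray through `u a`, whose weight is 1. The
  -- generator of that ray agrees with `u a` only pointwise, hence the transport.
  multiplicity : ∀ a → ∃ λ (m : Vector ℕ (#rays F)) →
    (∀ i → IsMultiplicity (image i) (u a) (m i)) × sumℕ (λ i → weight F i ℕ.* m i) ≡ 1
  multiplicity a with j , G≗u ← u-ray a with m , isMult , w≡ ← weight-sum j =
    m , transport ∘ isMult , trans (sym w≡) (weight-one j)
    where
    transport : ∀ {w m} → IsMultiplicity w (generator G j) m → IsMultiplicity w (u a) m
    transport {m = m} (inj₁ (0<m , w≗)) = inj₁ (0<m , λ t → trans (w≗ t) (cong (ℤ._*_ (+ m)) (G≗u t)))
    transport (inj₂ (¬spans , m≡0)) = inj₂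
      ((λ (m , 0<m , w≗) → ¬spans (m , 0<m , λ t → trans (w≗ t) (cong (ℤ._*_ (+ m)) (sym (G≗u t))))) , m≡0)

  fibre⇒over : ∀ {i} → Fibre π F G i → ∃ (Over i)
  fibre⇒over (j , m , 0<m , w≗) with a , G≗u ← ray-u j =
    a , m , 0<m , λ t → trans (w≗ t) (cong (ℤ._*_ (+ m)) (G≗u t))

  over⇒0<mult : ∀ {i a m} → Over i a → IsMultiplicity (image i) (u a) m → 0 ℕ.< m
  over⇒0<mult o (inj₁ (0<m , _))    = 0<m
  over⇒0<mult o (inj₂ (¬spans , _)) = contradiction o ¬spans

  -- Each ray over `u a` contributes a positive term to a sum equal to 1, which leaves room for only
  -- one such ray.
  over-unique : ∀ {i j a} → Over i a → Over j a → i ≡ j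
  over-unique {i} {j} {a} oᵢ oⱼ with m , isMult , sum≡1 ← multiplicity a =
    sumℕ≤1⇒unique _ (ℕ.≤-reflexive sum≡1) i j (0<term i oᵢ) (0<term j oⱼ)
    where
    0<term : ∀ i → Over i a → 0 ℕ.< weight F i ℕ.* m i
    0<term i o = ℕ.*-mono-≤ (positive F i) (over⇒0<mult o (isMult i))

  -- The positive multiplicity is bounded by its weighted term, and that term by the whole sum,
  -- which is 1.
  image-over : ∀ {i a} → Over i a → image i ≗ u a
  image-over {i} {a} o with m , isMult , sum≡1 ← multiplicity a with isMult i
  ... | inj₂ (¬spans , _)  = contradiction o ¬spans
  ... | inj₁ (0<m , w≗)   = λ t → trans (w≗ t) (trans (cong (λ x → + x ℤ.* u a t) m≡1) (ℤ.*-identityˡ _))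
    where
    m≡1 : m i ≡ 1
    m≡1 = ℕ.≤-antisym
      (ℕ.≤-trans (ℕ.m≤n*m (m i) (weight F i) {{ℕ.>-nonZero (positive F i)}})
        (ℕ.≤-trans (entry≤sumℕ (λ i → weight F i ℕ.* m i) i) (ℕ.≤-reflexive sum≡1)))
      0<m

  -- Vanishing of an integer vector is decidable, and a nonzero image spans a ray of the
  -- push-forward.
  zero-or-over : ∀ i → image i ≗ 0ᵛ ⊎ ∃ (Over i)
  zero-or-over i with all? (λ t → image i t ℤ.≟ 0ℤ)
  ... | yes z = inj₁ z
  ... | no ¬z = inj₂ (fibre⇒over (image-ray i ¬z))

  -- The functional on `F` attached to a pair of rays of the Bergman fan.

  module _ (a b : Fin (suc k)) where

    l : Dual n
    l = pullback π (separate a b)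

    value : Ray F → ℤ
    value i = Dual.apply l (generator F i)

    open DualProperties (separate a b)

    value-zero : ∀ {i} → image i ≗ 0ᵛ → value i ≡ 0ℤ
    value-zero z = trans (apply-cong z) apply-0

    value-over : ∀ {i c} → Over i c → value i ≡ δ a c ℤ.- δ b c
    value-over {c = c} o = trans (apply-cong (image-over o)) (separate-u a b c)

    value-a : ∀ {i} → a ≢ b → Over i a → value i ≡ 1ℤ
    value-a a≢b o = trans (value-over o) (cong₂ ℤ._-_ (δ-refl a) (δ-≢ (a≢b ∘ sym)))

    value-b : ∀ {i} → a ≢ b → Over i b → value i ≡ -1ℤ
    value-b a≢b o = trans (value-over o) (cong₂ ℤ._-_ (δ-≢ a≢b) (δ-refl b))

    value-other : ∀ {i c} → a ≢ c → b ≢ c → Over i c → value i ≡ 0ℤ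
    value-other a≢c b≢c o = trans (value-over o) (cong₂ ℤ._-_ (δ-≢ a≢c) (δ-≢ b≢c))

    -- Truncation at 0 removes the value -1 over `u b`, and the other rays not over `u a` have value
    -- 0. What remains is the multiplicity over `u a`, so that `max0 l ∙ F` becomes the weight
    -- formula term by term.
    max0-value : a ≢ b → ∀ i {m} → IsMultiplicity (image i) (u a) m → 0ℤ ℤ.⊔ value i ≡ + m
    max0-value a≢b i {m} (inj₁ (0<m , w≗)) = cong (ℤ._⊔_ 0ℤ) (begin
      value i                                        ≡⟨ apply-cong w≗ ⟩
      Dual.apply (separate a b) (+ m · u a)          ≡⟨ apply-* (+ m) (u a) ⟩
      + m ℤ.* Dual.apply (separate a b) (u a)        ≡⟨ cong (ℤ._*_ (+ m)) (separate-u a b a) ⟩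
      + m ℤ.* (δ a a ℤ.- δ b a)                      ≡⟨ cong₂ (λ x y → + m ℤ.* (x ℤ.- y)) (δ-refl a) (δ-≢ (a≢b ∘ sym)) ⟩
      + m ℤ.* 1ℤ                                     ≡⟨ ℤ.*-identityʳ (+ m) ⟩
      + m                                            ∎)
    max0-value a≢b i (inj₂ (¬over , refl)) with zero-or-over i
    ... | inj₁ z = cong (ℤ._⊔_ 0ℤ) (value-zero z)
    ... | inj₂ (c , o) with a ≟ c
    ...   | yes refl = contradiction o ¬over
    ...   | no a≢c with b ≟ c
    ...     | yes refl = cong (ℤ._⊔_ 0ℤ) (value-b a≢b o)
    ...     | no b≢c = cong (ℤ._⊔_ 0ℤ) (value-other a≢c b≢c o)

    max0-l : a ≢ b → max0 l ∙ F ≡ 1ℤ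
    max0-l a≢b with m , isMult , sum≡1 ← multiplicity a = begin
      sumℤ (λ i → + weight F i ℤ.* (0ℤ ℤ.⊔ value i))
        ≡⟨ sum-cong-≗ (λ i → trans (cong (ℤ._*_ (+ weight F i)) (max0-value a≢b i (isMult i)))
                                   (sym (ℤ.pos-* (weight F i) (m i)))) ⟩
      sumℤ (λ i → + (weight F i ℕ.* m i))
        ≡⟨ sumℤ-pos (λ i → weight F i ℕ.* m i) ⟩
      + sumℕ (λ i → weight F i ℕ.* m i)
        ≡⟨ cong +_ sum≡1 ⟩
      1ℤ ∎

    over-of-value : ∀ i → ∣ value i ∣ ≡ 1 → Over i a ⊎ Over i b
    over-of-value i v≡1 with zero-or-over i
    ... | inj₁ z = contradiction (trans (sym (cong ∣_∣ (value-zero z))) v≡1) λ ()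
    ... | inj₂ (c , o) with a ≟ c
    ...   | yes refl = inj₁ o
    ...   | no a≢c with b ≟ c
    ...     | yes refl = inj₂ o
    ...     | no b≢c = contradiction (trans (sym (cong ∣_∣ (value-other a≢c b≢c o))) v≡1) λ ()

  over⇒related : ∀ {i j a b} → Over i a → Over j b → GalleryRelated F i j
  over⇒related {i} {j} {a} {b} oᵢ oⱼ with a ≟ b
  ... | yes refl = inj₁ (over-unique oᵢ oⱼ)
  ... | no a≢b = inj₂ (l a b , max0-l a b a≢b , to , from)
    where
    to : ∀ {r} → i ≡ r ⊎ j ≡ r → ∣ value a b r ∣ ≡ 1
    to (inj₁ refl) = cong ∣_∣ (value-a a b a≢b oᵢ)
    to (inj₂ refl) = cong ∣_∣ (value-b a b a≢b oⱼ)

    -- Uniqueness over `u a` and over `u b` identifies any ray of the gallery with `i` or `j`.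
    from : ∀ {r} → ∣ value a b r ∣ ≡ 1 → i ≡ r ⊎ j ≡ r
    from {r} v≡1 with over-of-value a b r v≡1
    ... | inj₁ o = inj₁ (over-unique oᵢ o)
    ... | inj₂ o = inj₂ (over-unique oⱼ o)

  fibre⇒related : ∀ {i j} → Fibre π F G i → Fibre π F G j → GalleryRelated F i j
  fibre⇒related fᵢ fⱼ = over⇒related (proj₂ (fibre⇒over fᵢ)) (proj₂ (fibre⇒over fⱼ))

lemma3p14 : ∀ {n k : ℕ} (F : TropicalFan n) → RaysSpan F →
    (π : LinearMap n k) (π∗F : TropicalFan k) → IsPushForward π F π∗F →
    IsBergman π∗F →
    ∃ λ (C : Pred (TropicalFan.Ray F) 0ℓ) → IsGalleryClass F C × Fibre π F π∗F ⊆ C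
-- The fibre is not empty: the push-forward has a ray through `u zero`, and some ray `i` of `F` maps
-- onto it. The class of `i` contains every other ray of the fibre, since any two of them are
-- related.
lemma3p14 F _ π π∗F pushForward bergman
  with j , _ ← IsBergman.u-ray bergman zero
  with i , i↦j ← IsPushForward.ray-image pushForward j =
  GalleryRelated F i , (i , id , id) , PushForward.fibre⇒related pushForward bergman (j , i↦j)
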